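{- Let $\mathcal{F}$ be a non-empty class of $\mathrm{A}$-frames and $\mathcal{G}$ a non-empty class of $\mathrm{B}$-frames ($\mathrm{A},\mathrm{B}$ disjoint finite alphabets). If $\mathrm{Log}\,\mathcal{F}$ and $\mathrm{Log}\,\mathcal{G}$ are locally tabular and $\mathrm{Log}(\mathcal{F}\times\mathcal{G})$ is $1$-finite, then $\mathrm{Log}(\mathcal{F}\times\mathcal{G})$ is locally tabular.
   Context: For an $\mathrm{A}$-frame $F$ on $X$ and a $\mathrm{B}$-frame $G$ on $Y$, $F\times G$ is the frame on $X\times Y$ where each $\mathrm{A}$-relation $R$ gives $(a,b)R^h(a',b)$ iff $aRa'$, and each $\mathrm{B}$-relation $S$ gives $(a,b)S^v(a,b')$ iff $bSb'$; $\mathcal{F}\times\mathcal{G}=\{F\times G:F\in\mathcal{F},G\in\mathcal{G}\}$. $\mathrm{Log}$ of a class is the set of formulas valid in all its frames. A logic $L$ is $k$-finite if it has only finitely many pairwise $L$-nonequivalent formulas in variables $p_0,\dots,p_{k-1}$, and locally tabular if it is $k$-finite for all finite $k$. -}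

module Defs where

open import Data.Nat using (ℕ; _<_)
open import Data.Fin using (Fin)
open import Data.Sum using (_⊎_; inj₁; inj₂)
open import Data.Product using (Σ; _×_; _,_; ∃)
open import Data.Empty using (⊥)
open import Relation.Nullary using (¬_)
open import Relation.Binary.PropositionalEquality using (_≡_)

data Form (I : Set) : Set where
  var : ℕ → Form I
  ⊥' : Form I
  _⇒_ : Form I → Form I → Form I
  □ : I → Form I → Form I

infixr 5 _⇒_

¬' : {I : Set} → Form I → Form I
¬' φ = φ ⇒ ⊥'

_∧'_ : {I : Set} → Form I → Form I → Form I
φ ∧' ψ = ¬' (φ ⇒ ¬' ψ)

_⇔_ : {I : Set} → Form I → Form I → Form I
φ ⇔ ψ = (φ ⇒ ψ) ∧' (ψ ⇒ φ)

data InVars {I : Set} (k : ℕ) : Form I → Set where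
  var : ∀ {n} → n < k → InVars k (var n)
  ⊥' : InVars k ⊥'
  _⇒_ : ∀ {φ ψ} → InVars k φ → InVars k ψ → InVars k (φ ⇒ ψ)
  □ : ∀ {i φ} → InVars k φ → InVars k (□ i φ)

record Frame (I : Set) : Set₁ where
  field
    W : Set
    R : I → W → W → Set
open Frame public

-- Truth at a point (Gödel–Gentzen style: atoms read as ¬¬V, so that the
-- semantics is the classical one and every truth value is ¬¬-stable).
_,_⊨_ : {I : Set} (F : Frame I) → (ℕ → W F → Set) → W F → Form I → Set
_,_⊨_ F V x (var n) = ¬ ¬ V n x
_,_⊨_ F V x ⊥' = ⊥
_,_⊨_ F V x (φ ⇒ ψ) = (F , V ⊨ x) φ → (F , V ⊨ x) ψ
_,_⊨_ F V x (□ i φ) = ∀ y → R F i x y → (F , V ⊨ y) φ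

Valid : {I : Set} → Frame I → Form I → Set₁
Valid F φ = ∀ (V : ℕ → W F → Set) (x : W F) → (F , V ⊨ x) φ

Class : Set → Set₂
Class I = Frame I → Set₁

Log : {I : Set} → Class I → Form I → Set₁
Log 𝓒 φ = ∀ F → 𝓒 F → Valid F φ

NonEmpty : {I : Set} → Class I → Set₁
NonEmpty 𝓒 = Σ (Frame _) 𝓒

KFinite : {I : Set} → ℕ → (Form I → Set₁) → Set₁
KFinite {I} k L =
  Σ ℕ λ n → Σ (Fin n → Form I) λ rep →
    (∀ j → InVars k (rep j)) ×
    (∀ φ → InVars k φ → Σ (Fin n) λ j → L (φ ⇔ rep j))

LocallyTabular : {I : Set} → (Form I → Set₁) → Set₁
LocallyTabular L = ∀ k → KFinite k L

_⊗_ : {A B : Set} → Frame A → Frame B → Frame (A ⊎ B)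
_⊗_ {A} {B} F G = record { W = W F × W G ; R = rel }
  where
  rel : A ⊎ B → W F × W G → W F × W G → Set
  rel (inj₁ a) (x , y) (x' , y') = R F a x x' × (y ≡ y')
  rel (inj₂ b) (x , y) (x' , y') = (x ≡ x') × R G b y y'

_⊗ᶜ_ : {A B : Set} → Class A → Class B → Class (A ⊎ B)
(𝓕 ⊗ᶜ 𝓖) H = Σ (Frame _) λ F → Σ (Frame _) λ G → 𝓕 F × 𝓖 G × (H ≡ F ⊗ G)

{-# OPTIONS --safe #-}
module Submission where

-- 1-finiteness of Log 𝓕 and Log 𝓖 makes their frames pretransitive and of finite height, since on long
-- strict chains the number of alternations of a single variable is definable.  If some F and some G
-- both had large clusters, F × G would contain a large grid on which the rows and columns of a
-- staircase can be peeled off one by one with a single variable, against 1-finiteness of the product.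
-- So in each product F × G one factor, say F, has small clusters.  Then the points of F are treated by
-- induction on height: along a small cluster of F a product formula becomes a tuple of 𝓖-formulas whose
-- extra atoms record the types realized strictly above the cluster, and local tabularity of Log 𝓖
-- leaves finitely many tuples.  Constructively, the bounds and the finitely many classes of formulas are
-- computed from the given data, while the case distinctions on frames occur only under a double
-- negation, which is harmless because truth is stable.

open import Defs renaming (_,_⊨_ to Sat)
open import Data.Bool using (Bool; true; false; if_then_else_; not)
open import Data.Empty using (⊥; ⊥-elim)
open import Data.Fin using (Fin; zero; suc; toℕ; fromℕ<; combine; remQuot; splitAt; _↑ˡ_; _↑ʳ_; funToFin; finToFun)
import Data.Fin.Properties as Fin
open import Data.List using (List; []; _∷_; _++_; map; length; lookup; upTo; allFin; cartesianProductWith)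
open import Data.List.Membership.Propositional using (_∈_; find)
open import Data.List.Membership.Propositional.Properties
import Data.List.Membership.DecPropositional as DecMembership
open import Data.List.Relation.Unary.All as All using (All; []; _∷_; all?)
open import Data.List.Relation.Unary.All.Properties using (¬All⇒Any¬; ¬Any⇒All¬)
open import Data.List.Relation.Unary.AllPairs using ([]; _∷_)
open import Data.List.Relation.Unary.Any as Any using (here; there)
open import Data.List.Relation.Unary.Any.Properties using (lookup-index)
open import Data.List.Relation.Unary.Unique.Propositional using (Unique)
open import Data.Nat using (ℕ; zero; suc; _+_; _*_; _^_; _≤_; _<_; z≤n; s≤s; _<?_)
import Data.Nat.Properties as ℕ
open import Data.Product using (Σ; ∃; ∃₂; _×_; _,_; proj₁; proj₂)
open import Data.Sum using (_⊎_; inj₁; inj₂; swap)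
open import Data.Unit using (⊤; tt)
open import Function using (_∘_; id)
open import Relation.Binary.Construct.Closure.ReflexiveTransitive using (Star; ε; _◅_; _◅◅_)
open import Relation.Binary.PropositionalEquality using (_≡_; refl; sym; trans; cong; cong₂; subst)
open import Relation.Nullary using (¬_; Dec; yes; no)
open import Relation.Nullary.Decidable using (¬¬-excluded-middle)

private variable
  I : Set

-- Double negation, stability and finite conjunctions

¬¬-Fin : ∀ {n} {P : Fin n → Set} → (∀ i → ¬ ¬ P i) → ¬ ¬ (∀ i → P i)
¬¬-Fin {zero} h k = k λ ()
¬¬-Fin {suc n} h k = h zero λ p → ¬¬-Fin (λ i → h (suc i)) λ ps →
  k λ { zero → p ; (suc i) → ps i }

Decides : Bool → Set → Set
Decides b P = (P → b ≡ true) × (b ≡ true → P)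

¬¬-decides : (P : Set) → ¬ ¬ (∃ λ b → Decides b P)
¬¬-decides P k = ¬¬-excluded-middle {A = P} λ
  { (yes p) → k (true , (λ _ → refl) , λ _ → p)
  ; (no ¬p) → k (false , (λ p → ⊥-elim (¬p p)) , λ ()) }

-- Atoms are double negations and `⇒` and `□` preserve stability.
stable : (F : Frame I) (V : ℕ → W F → Set) (x : W F) (φ : Form I) →
  ¬ ¬ Sat F V x φ → Sat F V x φ
stable F V x (var n) h k = h λ v → v k
stable F V x ⊥' h = h id
stable F V x (φ ⇒ ψ) h s = stable F V x ψ λ k → h λ f → k (f s)
stable F V x (□ i φ) h y r = stable F V y φ λ k → h λ f → k (f y r)

infix 4 _≃_
_≃_ : Set → Set → Set
P ≃ Q = (P → Q) × (Q → P)

⇔-elim : (F : Frame I) (V : ℕ → W F → Set) (x : W F) (φ ψ : Form I) →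
  Sat F V x (φ ⇔ ψ) → Sat F V x φ ≃ Sat F V x ψ
⇔-elim F V x φ ψ h =
  (λ p → stable F V x ψ λ k → h λ f _ → k (f p)) ,
  (λ q → stable F V x φ λ k → h λ _ g → k (g q))

⇔-intro : (F : Frame I) (V : ℕ → W F → Set) (x : W F) (φ ψ : Form I) →
  Sat F V x φ ≃ Sat F V x ψ → Sat F V x (φ ⇔ ψ)
⇔-intro F V x φ ψ (f , g) h = h f g

∧-elim : (F : Frame I) (V : ℕ → W F → Set) (x : W F) (φ ψ : Form I) →
  Sat F V x (φ ∧' ψ) → Sat F V x φ × Sat F V x ψ
∧-elim F V x φ ψ h =
  stable F V x φ (λ k → h λ p _ → k p) , stable F V x ψ (λ k → h λ _ q → k q)

∧-intro : (F : Frame I) (V : ℕ → W F → Set) (x : W F) (φ ψ : Form I) →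
  Sat F V x φ → Sat F V x ψ → Sat F V x (φ ∧' ψ)
∧-intro F V x φ ψ p q h = h p q

⊤' : Form I
⊤' = ⊥' ⇒ ⊥'

⋀ : ∀ {n} → (Fin n → Form I) → Form I
⋀ {n = zero} f = ⊤'
⋀ {n = suc n} f = f zero ∧' ⋀ (f ∘ suc)

⋀-elim : ∀ {n} (F : Frame I) (V : ℕ → W F → Set) (x : W F) (f : Fin n → Form I) →
  Sat F V x (⋀ f) → ∀ i → Sat F V x (f i)
⋀-elim F V x f h zero = proj₁ (∧-elim F V x _ (⋀ (f ∘ suc)) h)
⋀-elim F V x f h (suc i) =
  ⋀-elim F V x (f ∘ suc) (proj₂ (∧-elim F V x (f zero) _ h)) i

⋀-intro : ∀ {n} (F : Frame I) (V : ℕ → W F → Set) (x : W F) (f : Fin n → Form I) →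
  (∀ i → Sat F V x (f i)) → Sat F V x (⋀ f)
⋀-intro {n = zero} F V x f h = id
⋀-intro {n = suc n} F V x f h =
  ∧-intro F V x (f zero) (⋀ (f ∘ suc)) (h zero) (⋀-intro F V x (f ∘ suc) (h ∘ suc))

¬-vars : ∀ {k} {φ : Form I} → InVars k φ → InVars k (¬' φ)
¬-vars p = p ⇒ ⊥'

∧-vars : ∀ {k} {φ ψ : Form I} → InVars k φ → InVars k ψ → InVars k (φ ∧' ψ)
∧-vars p q = ¬-vars (p ⇒ ¬-vars q)

⋀-vars : ∀ {k n} {f : Fin n → Form I} → (∀ i → InVars k (f i)) → InVars k (⋀ f)
⋀-vars {n = zero} h = ⊥' ⇒ ⊥'
⋀-vars {n = suc n} h = ∧-vars (h zero) (⋀-vars (h ∘ suc))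

-- Finitely many classes of formulas: repetitions and representatives

EquivIn : Class I → Form I → Form I → Set₁
EquivIn 𝓒 φ ψ = ∀ F → 𝓒 F → ∀ V x → Sat F V x φ ≃ Sat F V x ψ

-- Pigeonhole on the indices of the first `n + 1` formulas. Every use of 1-finiteness below goes
-- through such a repetition.
repetition : ∀ {k} {𝓒 : Class I} → KFinite k (Log 𝓒) →
  (χ : ℕ → Form I) → (∀ i → InVars k (χ i)) →
  ∃₂ λ s t → s < t × EquivIn 𝓒 (χ s) (χ t)
repetition {𝓒 = 𝓒} (n , rep , _ , reduce) χ χ-vars =
  let i , j , i<j , eq = Fin.pigeonhole (ℕ.n<1+n n) (λ i → index (toℕ i))
  in toℕ i , toℕ j , i<j , λ F F∈ V x →
    let f , g = toRep (toℕ i) F F∈ V x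
        f′ , g′ = toRep (toℕ j) F F∈ V x
    in (λ s → g′ (subst (λ r → Sat F V x (rep r)) eq (f s))) ,
       (λ s → g (subst (λ r → Sat F V x (rep r)) (sym eq) (f′ s)))
  where
  index : ℕ → Fin n
  index i = proj₁ (reduce (χ i) (χ-vars i))
  toRep : ∀ i → EquivIn 𝓒 (χ i) (rep (index i))
  toRep i F F∈ V x =
    ⇔-elim F V x (χ i) (rep (index i)) (proj₂ (reduce (χ i) (χ-vars i)) F F∈ V x)

record Congruence (n : ℕ) (κ : Form I → Fin n) : Set where
  field
    ⇒-cong : ∀ {φ φ′ ψ ψ′} → κ φ ≡ κ φ′ → κ ψ ≡ κ ψ′ → κ (φ ⇒ ψ) ≡ κ (φ′ ⇒ ψ′)
    □-cong : ∀ i {φ φ′} → κ φ ≡ κ φ′ → κ (□ i φ) ≡ κ (□ i φ′)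

unique-length : ∀ {n} (xs : List (Fin n)) → Unique xs → length xs ≤ n
unique-length xs u = Fin.injective⇒≤ (λ {i} {j} → lookup-inj xs u i j)
  where
  lookup-inj : ∀ {n} (xs : List (Fin n)) → Unique xs → ∀ i j → lookup xs i ≡ lookup xs j → i ≡ j
  lookup-inj (x ∷ xs) (x∉ ∷ u) zero zero eq = refl
  lookup-inj (x ∷ xs) (x∉ ∷ u) zero (suc j) eq = ⊥-elim (All.lookup x∉ (∈-lookup j) eq)
  lookup-inj (x ∷ xs) (x∉ ∷ u) (suc i) zero eq = ⊥-elim (All.lookup x∉ (∈-lookup i) (sym eq))
  lookup-inj (x ∷ xs) (x∉ ∷ u) (suc i) (suc j) eq = cong suc (lookup-inj xs u i j eq)

-- Representatives are found by saturating a list of formulas with pairwise distinct classes; no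
-- class has to be decided empty, so this needs no decision procedure for L.
module Saturation {n : ℕ} (is : List I) (complete : ∀ i → i ∈ is)
  (k : ℕ) (κ : Form I → Fin n) (congruence : Congruence n κ) where

  open Congruence congruence
  open DecMembership (Fin._≟_ {n}) using (_∈?_)

  candidates : List (Form I) → List (Form I)
  candidates Φ = (⊥' ∷ map var (upTo k)) ++ (cartesianProductWith _⇒_ Φ Φ ++ cartesianProductWith □ is Φ)

  candidates-vars : ∀ Φ → (∀ {φ} → φ ∈ Φ → InVars k φ) → ∀ {χ} → χ ∈ candidates Φ → InVars k χ
  candidates-vars Φ h χ∈ with ∈-++⁻ (⊥' ∷ map var (upTo k)) χ∈
  ... | inj₁ (here refl) = ⊥'
  ... | inj₁ (there χ∈′) with _ , i∈ , refl ← ∈-map⁻ var χ∈′ = var (∈-upTo⁻ i∈)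
  ... | inj₂ χ∈′ with ∈-++⁻ (cartesianProductWith _⇒_ Φ Φ) χ∈′
  ...   | inj₁ χ∈″ with _ , _ , p , q , refl ← ∈-cartesianProductWith⁻ _⇒_ Φ Φ χ∈″ = h p ⇒ h q
  ...   | inj₂ χ∈″ with _ , _ , _ , q , refl ← ∈-cartesianProductWith⁻ □ is Φ χ∈″ = □ (h q)

  Saturated : List (Form I) → Set
  Saturated Φ = All (λ χ → κ χ ∈ map κ Φ) (candidates Φ)

  -- Each round adds a formula of a new class, so `fuel + length` is preserved; at fuel zero there
  -- would be more than `n` distinct classes.
  saturate : ∀ fuel Φ → All (InVars k) Φ → Unique (map κ Φ) → n < fuel + length (map κ Φ) →
    ∃ λ Ψ → All (InVars k) Ψ × Saturated Ψ
  saturate zero Φ v u lt = ⊥-elim (ℕ.<⇒≱ lt (unique-length (map κ Φ) u))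
  saturate (suc fuel) Φ v u lt with all? (λ χ → κ χ ∈? map κ Φ) (candidates Φ)
  ... | yes saturated = Φ , v , saturated
  ... | no ¬saturated with χ , χ∈ , new ← find (¬All⇒Any¬ (λ χ → κ χ ∈? map κ Φ) (candidates Φ) ¬saturated) =
    saturate fuel (χ ∷ Φ) (candidates-vars Φ (All.lookup v) χ∈ ∷ v) (¬Any⇒All¬ _ new ∷ u)
      (subst (n <_) (sym (ℕ.+-suc fuel _)) lt)

  -- By congruence, immediate subformulas may be replaced by their representatives in `Φ`. The
  -- result is a candidate, and saturation covers candidates.
  represent : ∀ Φ → Saturated Φ → ∀ {φ} → InVars k φ → κ φ ∈ map κ Φ
  represent Φ sat = go
    where
    go : ∀ {φ} → InVars k φ → κ φ ∈ map κ Φ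
    go (var i<k) = All.lookup sat (there (∈-++⁺ˡ (∈-map⁺ var (∈-upTo⁺ i<k))))
    go ⊥' = All.lookup sat (here refl)
    go (p ⇒ q)
      with φ , φ∈ , eq ← ∈-map⁻ κ (go p) | ψ , ψ∈ , eq′ ← ∈-map⁻ κ (go q) =
      subst (_∈ map κ Φ) (⇒-cong (sym eq) (sym eq′))
        (All.lookup sat (∈-++⁺ʳ (⊥' ∷ map var (upTo k)) (∈-++⁺ˡ (∈-cartesianProductWith⁺ _⇒_ φ∈ ψ∈))))
    go (□ {i} p) with φ , φ∈ , eq ← ∈-map⁻ κ (go p) =
      subst (_∈ map κ Φ) (□-cong i (sym eq))
        (All.lookup sat (∈-++⁺ʳ (⊥' ∷ map var (upTo k))
          (∈-++⁺ʳ (cartesianProductWith _⇒_ Φ Φ) (∈-cartesianProductWith⁺ □ (complete i) φ∈))))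

  kfinite : (L : Form I → Set₁) →
    (∀ φ ψ → InVars k φ → InVars k ψ → κ φ ≡ κ ψ → L (φ ⇔ ψ)) → KFinite k L
  kfinite L sound with Φ , v , sat ← saturate (suc n) [] [] [] (ℕ.m≤m+n (suc n) 0) =
    length Φ , lookup Φ , (λ j → All.lookup v (∈-lookup j)) , λ φ φ-vars →
      let ψ , ψ∈ , eq = ∈-map⁻ κ (represent Φ sat φ-vars)
      in Any.index ψ∈ , sound φ _ φ-vars (All.lookup v (∈-lookup (Any.index ψ∈)))
           (trans eq (cong κ (lookup-index ψ∈)))

-- The normal forms `nf` take an `InVars` proof as argument; irrelevance makes them depend on the
-- formula alone.
InVars-irrelevant : ∀ {k} {φ : Form I} (p q : InVars k φ) → p ≡ q
InVars-irrelevant (var p) (var q) = cong var (ℕ.≤-irrelevant p q)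
InVars-irrelevant ⊥' ⊥' = refl
InVars-irrelevant (p ⇒ p′) (q ⇒ q′) = cong₂ _⇒_ (InVars-irrelevant p q) (InVars-irrelevant p′ q′)
InVars-irrelevant (□ p) (□ q) = cong □ (InVars-irrelevant p q)

⋀-cong : ∀ {n} {f g : Fin n → Form I} → (∀ i → f i ≡ g i) → ⋀ f ≡ ⋀ g
⋀-cong {n = zero} h = refl
⋀-cong {n = suc n} h = cong₂ _∧'_ (h zero) (⋀-cong (h ∘ suc))

-- Finite tables coded as numbers

bit : Bool → Fin 2
bit false = zero
bit true = suc zero

isOne : Fin 2 → Bool
isOne zero = false
isOne (suc _) = true

isOne-bit : ∀ b → isOne (bit b) ≡ b
isOne-bit false = refl
isOne-bit true = refl

funToFin-injective : ∀ {m n} (f g : Fin m → Fin n) → funToFin f ≡ funToFin g → ∀ i → f i ≡ g i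
funToFin-injective {m} {n} f g eq i =
  trans (sym (Fin.finToFun-funToFin f i))
    (trans (cong (λ u → finToFun {n} {m} u i) eq) (Fin.finToFun-funToFin g i))

funToFin-cong : ∀ {m n} {f g : Fin m → Fin n} → (∀ i → f i ≡ g i) → funToFin f ≡ funToFin g
funToFin-cong {zero} h = refl
funToFin-cong {suc m} h = cong₂ combine (h zero) (funToFin-cong (h ∘ suc))

guard : Bool → Form I → Form I
guard b φ = if b then φ else ⊤'

guard-vars : ∀ {k} b {φ : Form I} → InVars k φ → InVars k (guard b φ)
guard-vars true p = p
guard-vars false p = ⊥' ⇒ ⊥'

-- A frame has clusters of size at most N and height at most d when all its points are bounded; the
-- set listed by e (possibly with repetitions) plays the role of the cluster of x.
Bounded : (F : Frame I) → ℕ → ℕ → W F → Set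
Bounded F N zero x = ⊥
Bounded F N (suc d) x = ¬ ¬ Σ (Fin N → W F) λ e → (∃ λ c → e c ≡ x) ×
  (∀ c i y → R F i (e c) y → ¬ ¬ ((∃ λ c′ → e c′ ≡ y) ⊎ Bounded F N d y))

Bounded-stable : (F : Frame I) (N d : ℕ) (x : W F) → ¬ ¬ Bounded F N d x → Bounded F N d x
Bounded-stable F N zero x h = h id
Bounded-stable F N (suc d) x h k = h λ f → f k

-- Types of points, by induction on height

module Types {a b : ℕ} (𝓖 : Class (Fin b)) (𝓖-tabular : LocallyTabular (Log 𝓖)) (k N : ℕ) where

  Formula : Set
  Formula = Form (Fin a ⊎ Fin b)

  Realizes : (F : Frame (Fin a)) (G : Frame (Fin b)) → (ℕ → W (F ⊗ G) → Set) →
    W F → W G → (Formula → Bool) → Set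
  Realizes F G V x g σ = ∀ φ → InVars k φ → Decides (σ φ) (Sat (F ⊗ G) V (x , g) φ)

  -- Apart from `realized`, no field mentions frames. The types are only candidates: some may occur
  -- in no frame.
  record Level (d : ℕ) : Set₁ where
    field
      types : ℕ
      sat : Fin types → Formula → Bool
      classes : ℕ
      κ : Formula → Fin classes
      congruence : Congruence classes κ
      sat-cong : ∀ {φ ψ} → κ φ ≡ κ ψ → ∀ t → sat t φ ≡ sat t ψ
      realized : ∀ F G → 𝓖 G → ∀ V x g → Bounded F N d x → ¬ ¬ ∃ λ t → Realizes F G V x g (sat t)

  base : Level 0
  base = record
    { types = 0 ; sat = λ () ; classes = 1 ; κ = λ _ → zero
    ; congruence = record { ⇒-cong = λ _ _ → refl ; □-cong = λ _ _ → refl }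
    ; sat-cong = λ _ () ; realized = λ _ _ _ _ _ _ () }

  -- Along a listed set e : Fin N → W F, a product formula at (e c , g) is turned into a 𝓖-formula at
  -- g.  Its atoms are p i c, "variable i holds at (e c , g)", and q c i t, "e c has an i-successor y
  -- such that (y , g) realizes the type t of the previous level".
  module Step {d : ℕ} (level : Level d) where
    open Level level renaming (sat to satₗ; types to typesₗ; κ to κₗ; classes to classesₗ; realized to realizedₗ; sat-cong to sat-congₗ)
    open Congruence congruence renaming (⇒-cong to ⇒-congₗ; □-cong to □-congₗ)

    atoms : ℕ
    atoms = k * N + N * (a * typesₗ)

    p : Fin k → Fin N → Fin atoms
    p i c = combine i c ↑ˡ _

    q : Fin N → Fin a → Fin typesₗ → Fin atoms
    q c i t = (k * N) ↑ʳ combine c (combine i t)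

    n : ℕ
    n = proj₁ (𝓖-tabular atoms)

    rep : Fin n → Form (Fin b)
    rep = proj₁ (proj₂ (𝓖-tabular atoms))

    rep-vars : ∀ j → InVars atoms (rep j)
    rep-vars = proj₁ (proj₂ (proj₂ (𝓖-tabular atoms)))

    nf : (φ : Form (Fin b)) → InVars atoms φ → Fin n
    nf φ v = proj₁ (proj₂ (proj₂ (proj₂ (𝓖-tabular atoms))) φ v)

    nf-sound : ∀ φ v → EquivIn 𝓖 φ (rep (nf φ v))
    nf-sound φ v G G∈ V g =
      ⇔-elim G V g φ (rep (nf φ v)) (proj₂ (proj₂ (proj₂ (proj₂ (𝓖-tabular atoms))) φ v) G G∈ V g)

    nf-cong : ∀ {φ ψ v w} → φ ≡ ψ → nf φ v ≡ nf ψ w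
    nf-cong {v = v} {w} refl = cong (nf _) (InVars-irrelevant v w)

    -- `C : Fin frames` codes the `a` relations that a frame induces on the `N` listed points.
    frames : ℕ
    frames = 2 ^ (a * (N * N))

    edge : Fin frames → Fin a → Fin N → Fin N → Bool
    edge C i c c′ = isOne (finToFun C (combine i (combine c c′)))

    -- A horizontal box is split in two: `boxIn` treats successors on the list, `boxOut` forbids
    -- successors whose lower type refutes the formula.
    boxIn : Fin frames → Fin a → Fin N → (Fin N → Fin n) → Form (Fin b)
    boxIn C i c v = ⋀ λ c′ → guard (edge C i c c′) (rep (v c′))

    boxOut : Fin a → Fin N → (Fin typesₗ → Bool) → Form (Fin b)
    boxOut i c τ = ⋀ λ t → guard (not (τ t)) (¬' (var (toℕ (q c i t))))

    box-vars : ∀ C i c v τ → InVars atoms (boxIn C i c v ∧' boxOut i c τ)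
    box-vars C i c v τ = ∧-vars
      (⋀-vars λ c′ → guard-vars (edge C i c c′) (rep-vars (v c′)))
      (⋀-vars λ t → guard-vars (not (τ t)) (¬-vars (var (Fin.toℕ<n (q c i t)))))

    varAt : ∀ {i} → Dec (i < k) → Fin N → Fin n
    varAt (yes i<k) c = nf (var (toℕ (p (fromℕ< i<k) c))) (var (Fin.toℕ<n _))
    -- Default for variables beyond the first `k`, which `translate` excludes.
    varAt (no _) c = nf ⊥' ⊥'

    -- The 𝓖-formula expressing a product formula at `(e c , g)`; normalizing at every connective
    -- keeps the values in the finite set `Fin n`.
    val : Formula → Fin frames → Fin N → Fin n
    val (var i) C c = varAt (i <? k) c
    val ⊥' C c = nf ⊥' ⊥'
    val (φ ⇒ ψ) C c = nf (rep (val φ C c) ⇒ rep (val ψ C c)) (rep-vars _ ⇒ rep-vars _)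
    val (□ (inj₁ i) φ) C c =
      nf (boxIn C i c (val φ C) ∧' boxOut i c (λ t → satₗ t φ)) (box-vars C i c (val φ C) (λ t → satₗ t φ))
    val (□ (inj₂ j) φ) C c = nf (□ j (rep (val φ C c))) (□ (rep-vars _))

    -- A type is a code of the relations on the list, a position on it, and the set of
    -- representatives true at `g`.
    types : ℕ
    types = frames * (N * 2 ^ n)

    satAt : Fin frames → Fin N × Fin (2 ^ n) → Formula → Bool
    satAt C (c , s) φ = isOne (finToFun s (val φ C c))

    sat : Fin types → Formula → Bool
    sat t with C , u ← remQuot {frames} (N * 2 ^ n) t = satAt C (remQuot {N} (2 ^ n) u)

    table : Formula → Fin (n ^ (frames * N))
    table φ = funToFin {frames * N} λ u → val φ (proj₁ (remQuot {frames} N u)) (proj₂ (remQuot {frames} N u))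

    -- The lower class is kept because `val` of a horizontal box consults `satₗ t φ`, which `κₗ`
    -- controls.
    κ : Formula → Fin (classesₗ * n ^ (frames * N))
    κ φ = combine (κₗ φ) (table φ)

    κ-lower : ∀ {φ ψ} → κ φ ≡ κ ψ → κₗ φ ≡ κₗ ψ
    κ-lower {φ} {ψ} = Fin.combine-injectiveˡ (κₗ φ) (table φ) (κₗ ψ) (table ψ)

    κ-val : ∀ {φ ψ} → κ φ ≡ κ ψ → ∀ C c → val φ C c ≡ val ψ C c
    κ-val {φ} {ψ} eq C c =
      subst (λ u → val φ (proj₁ u) (proj₂ u) ≡ val ψ (proj₁ u) (proj₂ u)) (Fin.remQuot-combine C c)
        (funToFin-injective {frames * N} _ _
          (Fin.combine-injectiveʳ (κₗ φ) (table φ) (κₗ ψ) (table ψ) eq) (combine C c))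

    κ-intro : ∀ {φ ψ} → κₗ φ ≡ κₗ ψ → (∀ C c → val φ C c ≡ val ψ C c) → κ φ ≡ κ ψ
    κ-intro eq h = cong₂ combine eq (funToFin-cong {frames * N} λ u → h (proj₁ (remQuot {frames} N u)) (proj₂ (remQuot {frames} N u)))

    κ-congruence : Congruence _ κ
    κ-congruence = record
      { ⇒-cong = λ {φ} {φ′} {ψ} {ψ′} e e′ →
          κ-intro {φ ⇒ ψ} {φ′ ⇒ ψ′} (⇒-congₗ (κ-lower e) (κ-lower e′)) λ C c →
            nf-cong (cong₂ _⇒_ (cong rep (κ-val e C c)) (cong rep (κ-val e′ C c)))
      ; □-cong = □-κ }
      where
      □-κ : ∀ i {φ φ′} → κ φ ≡ κ φ′ → κ (□ i φ) ≡ κ (□ i φ′)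
      □-κ (inj₁ i) {φ} {φ′} e = κ-intro {□ (inj₁ i) φ} {□ (inj₁ i) φ′} (□-congₗ (inj₁ i) (κ-lower e)) λ C c →
        nf-cong (cong₂ _∧'_
          (⋀-cong λ c′ → cong (λ j → guard (edge C i c c′) (rep j)) (κ-val e C c′))
          (⋀-cong λ t → cong (λ s → guard (not s) (¬' (var (toℕ (q c i t))))) (sat-congₗ (κ-lower e) t)))
      □-κ (inj₂ j) {φ} {φ′} e = κ-intro {□ (inj₂ j) φ} {□ (inj₂ j) φ′} (□-congₗ (inj₂ j) (κ-lower e)) λ C c →
        nf-cong (cong (λ r → □ j (rep r)) (κ-val e C c))

    sat-cong : ∀ {φ ψ} → κ φ ≡ κ ψ → ∀ t → sat t φ ≡ sat t ψ
    sat-cong {φ} {ψ} eq t = cong (λ j → isOne (finToFun s j)) (κ-val {φ} {ψ} eq C c)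
      where
      C = proj₁ (remQuot {frames} (N * 2 ^ n) t)
      c = proj₁ (remQuot {N} (2 ^ n) (proj₂ (remQuot {frames} (N * 2 ^ n) t)))
      s = proj₂ (remQuot {N} (2 ^ n) (proj₂ (remQuot {frames} (N * 2 ^ n) t)))

    module Translation (F : Frame (Fin a)) (G : Frame (Fin b)) (G∈ : 𝓖 G)
      (V : ℕ → W (F ⊗ G) → Set) (e : Fin N → W F)
      (exits : ∀ c i y → R F i (e c) y → ¬ ¬ ((∃ λ c′ → e c′ ≡ y) ⊎ Bounded F N d y))
      (C : Fin frames) (C-edges : ∀ i c c′ → Decides (edge C i c c′) (R F i (e c) (e c′))) where

      pAtom : W G → Fin k × Fin N → Set
      pAtom g (i , c) = V (toℕ i) (e c , g)

      qAtom : W G → Fin N → Fin a × Fin typesₗ → Set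
      qAtom g c (i , t) = ∃ λ y → R F i (e c) y × Realizes F G V y g (satₗ t)

      atomAt : W G → Fin (k * N) ⊎ Fin (N * (a * typesₗ)) → Set
      atomAt g (inj₁ u) = pAtom g (remQuot {k} N u)
      atomAt g (inj₂ u) with c , w ← remQuot {N} (a * typesₗ) u = qAtom g c (remQuot {a} typesₗ w)

      VG : ℕ → W G → Set
      VG v g with v <? atoms
      ... | yes v< = atomAt g (splitAt (k * N) (fromℕ< v<))
      ... | no _ = ⊥

      VG-toℕ : ∀ u g → VG (toℕ u) g ≡ atomAt g (splitAt (k * N) u)
      VG-toℕ u g with toℕ u <? atoms
      ... | yes u< = cong (λ w → atomAt g (splitAt (k * N) w)) (Fin.fromℕ<-toℕ u u<)
      ... | no u≮ = ⊥-elim (u≮ (Fin.toℕ<n u))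

      VG-p : ∀ i c g → VG (toℕ (p i c)) g ≡ V (toℕ i) (e c , g)
      VG-p i c g = trans (VG-toℕ (p i c) g)
        (trans (cong (atomAt g) (Fin.splitAt-↑ˡ (k * N) (combine i c) (N * (a * typesₗ))))
          (cong (pAtom g) (Fin.remQuot-combine i c)))

      VG-q : ∀ c i t g → VG (toℕ (q c i t)) g ≡ ∃ λ y → R F i (e c) y × Realizes F G V y g (satₗ t)
      VG-q c i t g = trans (VG-toℕ (q c i t) g)
        (trans (cong (atomAt g) (Fin.splitAt-↑ʳ (k * N) (N * (a * typesₗ)) (combine c (combine i t))))
          (trans (cong (λ u → qAtom g (proj₁ u) (remQuot {a} typesₗ (proj₂ u))) (Fin.remQuot-combine c (combine i t)))
            (cong (qAtom g c) (Fin.remQuot-combine i t))))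

      Holds : W G → Form (Fin b) → Set
      Holds = Sat G VG

      Holds× : Fin N → W G → Formula → Set
      Holds× c g = Sat (F ⊗ G) V (e c , g)

      via-nf : ∀ {P : Set} {g} φ v → P ≃ Holds g φ → P ≃ Holds g (rep (nf φ v))
      via-nf {g = g} φ v (to , from) with to′ , from′ ← nf-sound φ v G G∈ VG g =
        (λ x → to′ (to x)) , (λ y → from (from′ y))

      -- If a type refuting `φ` had its `q` atom true at `g`, some `i`-successor of `e c` would
      -- refute `φ`, against the box.
      box-to : ∀ i φ c g → (∀ c′ → Holds× c′ g φ ≃ Holds g (rep (val φ C c′))) → InVars k φ →
        Holds× c g (□ (inj₁ i) φ) → Holds g (boxIn C i c (val φ C) ∧' boxOut i c (λ t → satₗ t φ))
      box-to i φ c g IH v h = ∧-intro G VG g (boxIn C i c (val φ C)) (boxOut i c λ t → satₗ t φ)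
        (⋀-intro G VG g _ inner) (⋀-intro G VG g _ outer)
        where
        inner : ∀ c′ → Holds g (guard (edge C i c c′) (rep (val φ C c′)))
        inner c′ with edge C i c c′ in eq
        ... | true = proj₁ (IH c′) (h _ (proj₂ (C-edges i c c′) eq , refl))
        ... | false = id
        outer : ∀ t → Holds g (guard (not (satₗ t φ)) (¬' (var (toℕ (q c i t)))))
        outer t with satₗ t φ in eq
        ... | true = id
        ... | false = λ ¬¬q → ¬¬q λ q-holds → absurd (subst id (VG-q c i t g) q-holds)
          where
          absurd : (∃ λ y → R F i (e c) y × Realizes F G V y g (satₗ t)) → ⊥
          absurd (y , r , real) with () ← trans (sym (proj₁ (real φ v) (h _ (r , refl)))) eq

      -- A successor `y` is listed, where `boxIn` and `IH` apply, or lower, where it realizes some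
      -- `t`; then `q c i t` is true, and `boxOut` rules out a `t` refuting `φ`.
      box-from : ∀ i φ c g → (∀ c′ → Holds× c′ g φ ≃ Holds g (rep (val φ C c′))) → InVars k φ →
        Holds g (boxIn C i c (val φ C) ∧' boxOut i c (λ t → satₗ t φ)) → Holds× c g (□ (inj₁ i) φ)
      box-from i φ c g IH v h (y , _) (r , refl) =
        stable (F ⊗ G) V (y , g) φ λ ¬φ → exits c i y r λ
          { (inj₁ (c′ , refl)) → ¬φ (inner c′ r)
          ; (inj₂ bounded) → realizedₗ F G G∈ V y g bounded λ { (t , real) → outer t real ¬φ } }
        where
        conjuncts = ∧-elim G VG g (boxIn C i c (val φ C)) (boxOut i c λ t → satₗ t φ) h
        inner : ∀ c′ → R F i (e c) (e c′) → Holds× c′ g φ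
        inner c′ r′ = proj₂ (IH c′) (subst (λ b → Holds g (guard b (rep (val φ C c′))))
          (proj₁ (C-edges i c c′) r′)
          (⋀-elim G VG g (λ c″ → guard (edge C i c c″) (rep (val φ C c″))) (proj₁ conjuncts) c′))
        outer : ∀ t → Realizes F G V y g (satₗ t) → ¬ ¬ Sat (F ⊗ G) V (y , g) φ
        outer t real ¬φ
          with satₗ t φ in eq
            | ⋀-elim G VG g (λ t → guard (not (satₗ t φ)) (¬' (var (toℕ (q c i t))))) (proj₂ conjuncts) t
        ... | true | _ = ¬φ (proj₂ (real φ v) eq)
        ... | false | ¬q = ¬q λ k → k (subst id (sym (VG-q c i t g)) (y , r , real))

      -- The induction keeps `c` and `g` general: a horizontal box needs all listed points at the
      -- same `g`, a vertical box all `g′` at the same `c`.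
      translate : ∀ φ → InVars k φ → ∀ c g → Holds× c g φ ≃ Holds g (rep (val φ C c))
      translate (var i) (var i<k) c g with i <? k
      ... | no i≮k = ⊥-elim (i≮k i<k)
      ... | yes i<k′ = via-nf (var (toℕ (p (fromℕ< i<k′) c))) (var (Fin.toℕ<n _))
        (subst (λ A → (¬ ¬ A) ≃ Holds g (var (toℕ (p (fromℕ< i<k′) c))))
          (trans (VG-p (fromℕ< i<k′) c g) (cong (λ j → V j (e c , g)) (Fin.toℕ-fromℕ< i<k′)))
          (id , id))
      translate ⊥' ⊥' c g = via-nf ⊥' ⊥' (id , id)
      translate (φ ⇒ ψ) (v ⇒ w) c g with to , from ← translate φ v c g | to′ , from′ ← translate ψ w c g =
        via-nf (rep (val φ C c) ⇒ rep (val ψ C c)) (rep-vars _ ⇒ rep-vars _)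
          ((λ h s → to′ (h (from s))) , (λ h s → from′ (h (to s))))
      translate (□ (inj₁ i) φ) (□ v) c g =
        via-nf (boxIn C i c (val φ C) ∧' boxOut i c (λ t → satₗ t φ)) (box-vars C i c (val φ C) (λ t → satₗ t φ))
          (box-to i φ c g (λ c′ → translate φ v c′ g) v , box-from i φ c g (λ c′ → translate φ v c′ g) v)
      translate (□ (inj₂ j) φ) (□ v) c g = via-nf (□ j (rep (val φ C c))) (□ (rep-vars _))
        ( (λ h g′ r → proj₁ (translate φ v c g′) (h _ (refl , r)))
        , λ { h (_ , g′) (refl , r) → proj₂ (translate φ v c g′) (h g′ r) } )

    sat-combine : ∀ C c (s : Fin n → Bool) φ →
      sat (combine C (combine c (funToFin (bit ∘ s)))) φ ≡ s (val φ C c)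
    sat-combine C c s φ = trans
      (cong (λ w → satAt (proj₁ w) (remQuot {N} (2 ^ n) (proj₂ w)) φ) (Fin.remQuot-combine C (combine c code)))
      (trans (cong (λ w → satAt C w φ) (Fin.remQuot-combine c code))
        (trans (cong isOne (Fin.finToFun-funToFin (bit ∘ s) (val φ C c))) (isOne-bit _)))
      where code = funToFin (bit ∘ s)

    edge-code : (E : Fin a → Fin N → Fin N → Bool) → ∃ λ C → ∀ i c c′ → edge C i c c′ ≡ E i c c′
    edge-code E = funToFin table′ , λ i c c′ →
      trans (cong isOne (Fin.finToFun-funToFin table′ (combine i (combine c c′)))) (read i c c′)
      where
      entry : Fin a → Fin N × Fin N → Fin 2
      entry i (c , c′) = bit (E i c c′)
      table′ : Fin (a * (N * N)) → Fin 2
      table′ u with i , w ← remQuot {a} (N * N) u = entry i (remQuot {N} N w)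
      read : ∀ i c c′ → isOne (table′ (combine i (combine c c′))) ≡ E i c c′
      read i c c′ = trans
        (cong (λ u → isOne (entry (proj₁ u) (remQuot {N} N (proj₂ u)))) (Fin.remQuot-combine i (combine c c′)))
        (trans (cong (isOne ∘ entry i) (Fin.remQuot-combine c c′)) (isOne-bit _))

    -- Only finitely many truth values are chosen, for the relations on the list and the
    -- representatives at `g`, so `¬¬-Fin` allows the choice.
    realized : ∀ F G → 𝓖 G → ∀ V x g → Bounded F N (suc d) x → ¬ ¬ ∃ λ t → Realizes F G V x g (sat t)
    realized F G G∈ V x g bounded done = bounded λ { (e , (c , refl) , exits) →
      ¬¬-Fin (λ i → ¬¬-Fin λ c′ → ¬¬-Fin λ c″ → ¬¬-decides (R F i (e c′) (e c″))) λ E →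
      let C , C≡ = edge-code λ i c′ c″ → proj₁ (E i c′ c″)
          open Translation F G G∈ V e exits C
            (λ i c′ c″ → subst (λ b → Decides b (R F i (e c′) (e c″))) (sym (C≡ i c′ c″)) (proj₂ (E i c′ c″)))
      in ¬¬-Fin (λ j → ¬¬-decides (Holds g (rep j))) λ S →
      done (combine C (combine c (funToFin (bit ∘ λ j → proj₁ (S j)))) , λ φ v →
        subst (λ b → Decides b (Holds× c g φ)) (sym (sat-combine C c (λ j → proj₁ (S j)) φ))
          ( (λ h → proj₁ (proj₂ (S (val φ C c))) (proj₁ (translate φ v c g) h))
          , (λ h → proj₂ (translate φ v c g) (proj₂ (proj₂ (S (val φ C c))) h)))) }

    next : Level (suc d)
    next = record
      { types = types ; sat = sat ; classes = _ ; κ = κ ; congruence = κ-congruence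
      ; sat-cong = λ {φ} {ψ} → sat-cong {φ} {ψ} ; realized = realized }

  level : ∀ d → Level d
  level zero = base
  level (suc d) = Step.next (level d)

-- Modalities of bounded depth

module Iterated {a : ℕ} (ι : Fin a → I) where

  -- `ι` selects the modalities: all those of a factor (`id`), or the horizontal (`inj₁`) or
  -- vertical (`inj₂`) ones of a product.
  □≤ : ℕ → Form I → Form I
  □≤ zero φ = φ
  □≤ (suc m) φ = φ ∧' ⋀ λ i → □ (ι i) (□≤ m φ)

  ◇≤ : ℕ → Form I → Form I
  ◇≤ m φ = ¬' (□≤ m (¬' φ))

  □≤-vars : ∀ {k} m {φ} → InVars k φ → InVars k (□≤ m φ)
  □≤-vars zero v = v
  □≤-vars (suc m) v = ∧-vars v (⋀-vars λ i → □ (□≤-vars m v))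

  ◇≤-vars : ∀ {k} m {φ} → InVars k φ → InVars k (◇≤ m φ)
  ◇≤-vars m v = ¬-vars (□≤-vars m (¬-vars v))

  module _ (H : Frame I) where

    Steps : ℕ → W H → W H → Set
    Steps zero x y = x ≡ y
    Steps (suc m) x y = x ≡ y ⊎ ∃₂ λ i z → R H (ι i) x z × Steps m z y

    Steps-mono : ∀ {m m′} → m ≤ m′ → ∀ {x y} → Steps m x y → Steps m′ x y
    Steps-mono {m′ = zero} z≤n eq = eq
    Steps-mono {m′ = suc m′} z≤n eq = inj₁ eq
    Steps-mono (s≤s le) (inj₁ eq) = inj₁ eq
    Steps-mono (s≤s le) (inj₂ (i , z , r , s)) = inj₂ (i , z , r , Steps-mono le s)

    module _ (V : ℕ → W H → Set) (φ : Form I) where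

      □≤-elim : ∀ m {x y} → Sat H V x (□≤ m φ) → Steps m x y → Sat H V y φ
      □≤-elim zero h refl = h
      □≤-elim (suc m) {x} h (inj₁ refl) = proj₁ (∧-elim H V x φ (⋀ λ i → □ (ι i) (□≤ m φ)) h)
      □≤-elim (suc m) {x} h (inj₂ (i , z , r , s)) = □≤-elim m
        (⋀-elim H V x (λ i → □ (ι i) (□≤ m φ)) (proj₂ (∧-elim H V x φ (⋀ λ i → □ (ι i) (□≤ m φ)) h)) i z r) s

      □≤-intro : ∀ m {x} → (∀ y → Steps m x y → Sat H V y φ) → Sat H V x (□≤ m φ)
      □≤-intro zero h = h _ refl
      □≤-intro (suc m) {x} h = ∧-intro H V x φ (⋀ λ i → □ (ι i) (□≤ m φ)) (h x (inj₁ refl))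
        (⋀-intro H V x (λ i → □ (ι i) (□≤ m φ)) λ i z r → □≤-intro m λ y s → h y (inj₂ (i , z , r , s)))

    ◇≤-intro : ∀ V φ m {x y} → Steps m x y → Sat H V y φ → Sat H V x (◇≤ m φ)
    ◇≤-intro V φ m s p h = □≤-elim V (¬' φ) m h s p

    ◇≤-elim : ∀ V φ m {x} → Sat H V x (◇≤ m φ) → ¬ ¬ ∃ λ y → Steps m x y × Sat H V y φ
    ◇≤-elim V φ m h k = h (□≤-intro V (¬' φ) m λ y s p → k (y , s , p))

-- Pretransitivity and finite height of one factor

Reach : (F : Frame I) → W F → W F → Set
Reach F = Star λ x y → ∃ λ i → R F i x y

-- One unit of a chain consists of two strict ascents, x < v < u: this leaves room for a variable to be
-- true on the layer between x and v and false on the layer between v and u.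
Chain : (F : Frame I) → ℕ → W F → Set
Chain F zero x = ⊤
Chain F (suc h) x = ∃₂ λ v u → Reach F x v × ¬ Reach F v x × Reach F v u × ¬ Reach F u v × Chain F h u

module OneSided {a : ℕ} (𝓕 : Class (Fin a)) (𝓕-finite : KFinite 1 (Log 𝓕)) where

  open Iterated {I = Fin a} id

  private
    pretransitivity = repetition {𝓒 = 𝓕} 𝓕-finite (λ m → □≤ m (var 0)) (λ m → □≤-vars m (var (s≤s z≤n)))

  m : ℕ
  m = proj₁ pretransitivity

  -- Let the variable hold within `m` steps of `x`. Then `□≤ m` of it holds at `x`, hence also the
  -- equivalent `□≤ t` with `t > m`, so paths of `m + 1` steps shorten to `m`.
  reach⇒steps : ∀ F → 𝓕 F → ∀ {x y} → Reach F x y → ¬ ¬ Steps F m x y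
  reach⇒steps F F∈ ε k = k (Steps-mono F {m′ = m} z≤n refl)
  reach⇒steps F F∈ {x} {y} ((i , r) ◅ rs) k = reach⇒steps F F∈ rs λ s →
    □≤-elim F V (var 0) (proj₁ (proj₂ pretransitivity))
      (proj₁ (proj₂ (proj₂ (proj₂ pretransitivity)) F F∈ V x) (□≤-intro F V (var 0) m λ _ s′ k′ → k′ s′))
      (Steps-mono F (proj₁ (proj₂ (proj₂ pretransitivity))) (inj₂ (i , _ , r , s))) k
    where
    V : ℕ → W F → Set
    V _ = Steps F m x

  steps⇒reach : ∀ F n {x y} → Steps F n x y → Reach F x y
  steps⇒reach F zero refl = ε
  steps⇒reach F (suc n) (inj₁ refl) = ε
  steps⇒reach F (suc n) (inj₂ (i , _ , r , s)) = (i , r) ◅ steps⇒reach F n s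

  -- δ t asks for t alternations of the variable upwards; on a chain of length h whose alternate layers
  -- satisfy the variable, the root satisfies δ h but no later δ t.
  δ : ℕ → Form (Fin a)
  δ zero = var 0
  δ (suc t) = var 0 ∧' ◇≤ m (¬' (var 0) ∧' ◇≤ m (δ t))

  δ-vars : ∀ t → InVars 1 (δ t)
  δ-vars zero = var (s≤s z≤n)
  δ-vars (suc t) = ∧-vars (var (s≤s z≤n))
    (◇≤-vars m (∧-vars (¬-vars (var (s≤s z≤n))) (◇≤-vars m (δ-vars t))))

  module _ (F : Frame (Fin a)) (F∈ : 𝓕 F) where

    -- The alternating valuation: cones of the roots `x` minus cones of the following `v`, and at
    -- the end of the chain a whole cone.
    layers : ∀ h {x} → Chain F h x → W F → Set
    layers zero {x} c z = Reach F x z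
    layers (suc h) {x} (v , u , _ , _ , _ , _ , c) z = (Reach F x z × ¬ Reach F v z) ⊎ layers h c z

    layers⊆ : ∀ h {x} (c : Chain F h x) {z} → layers h c z → Reach F x z
    layers⊆ zero c r = r
    layers⊆ (suc h) c (inj₁ (r , _)) = r
    layers⊆ (suc h) (v , u , xv , _ , vu , _ , c) (inj₂ l) = xv ◅◅ vu ◅◅ layers⊆ h c l

    Agrees : (W F → Set) → ∀ h {x} → Chain F h x → Set
    Agrees P h {x} c = ∀ z → Reach F x z → P z ≃ layers h c z

    -- The first layer omits the cone of `v`. Starting at `v` rather than `u` includes the point
    -- where the variable must fail.
    agrees-tail : ∀ {P} h {x} (c : Chain F (suc h) x) → Agrees P (suc h) c →
      ∀ z → Reach F (proj₁ c) z → P z ≃ layers h (proj₂ (proj₂ (proj₂ (proj₂ (proj₂ (proj₂ c)))))) z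
    agrees-tail {P} h {x} (v , u , xv , _ , vu , _ , c) ag z vz = to , λ l → proj₂ (ag z (xv ◅◅ vz)) (inj₂ l)
      where
      to : P z → layers h c z
      to Pz with proj₁ (ag z (xv ◅◅ vz)) Pz
      ... | inj₁ (_ , ¬vz) = ⊥-elim (¬vz vz)
      ... | inj₂ l = l

    module _ (V : ℕ → W F → Set) where

      δ⇒p : ∀ t {z} → Sat F V z (δ t) → ¬ ¬ V 0 z
      δ⇒p zero h = h
      δ⇒p (suc t) {z} h = proj₁ (∧-elim F V z (var 0) (◇≤ m (¬' (var 0) ∧' ◇≤ m (δ t))) h)

      δ-top : ∀ h {x} (c : Chain F h x) → Agrees (V 0) h c → Sat F V x (δ h)
      δ-top zero c ag k = k (proj₂ (ag _ ε) ε)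
      δ-top (suc h) {x} C@(v , u , xv , ¬vx , vu , ¬uv , c) ag =
        ∧-intro F V x (var 0) (◇≤ m (¬' (var 0) ∧' ◇≤ m (δ h)))
          (λ k → k (proj₂ (ag x ε) (inj₁ (ε , ¬vx))))
          (λ box → reach⇒steps F F∈ xv λ s → reach⇒steps F F∈ vu λ s′ →
            ◇≤-intro F V (¬' (var 0) ∧' ◇≤ m (δ h)) m s
              (∧-intro F V v (¬' (var 0)) (◇≤ m (δ h))
                -- Layers of the tail lie above `u`, which does not reach `v`.
                (λ p → p λ Pv → ¬uv (layers⊆ h c (proj₁ (agrees-tail h C ag v ε) Pv)))
                (◇≤-intro F V (δ h) m s′
                  (δ-top h c λ z uz → agrees-tail h C ag z (vu ◅◅ uz)))) box)

      -- A point refuting the variable is above `v`, and points above it satisfying the variable are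
      -- above `u`: each alternation uses up one unit. In the final cone the variable never fails.
      δ-bound : ∀ h {x} (c : Chain F h x) → Agrees (V 0) h c →
        ∀ t {z} → Reach F x z → Sat F V z (δ t) → ¬ ¬ (t ≤ h)
      δ-bound h c ag zero xz _ k = k z≤n
      δ-bound h {x} c ag (suc t) {z} xz sat k =
        ◇≤-elim F V (¬' (var 0) ∧' ◇≤ m (δ t)) m
          (proj₂ (∧-elim F V z (var 0) (◇≤ m (¬' (var 0) ∧' ◇≤ m (δ t))) sat)) λ { (z′ , s′ , sat′) →
        let ¬p , sat◇ = ∧-elim F V z′ (¬' (var 0)) (◇≤ m (δ t)) sat′
        in ◇≤-elim F V (δ t) m sat◇ λ { (z″ , s″ , sat″) →
        descend h c ag (xz ◅◅ steps⇒reach F m s′) (λ p → ¬p λ ¬p′ → ¬p′ p) (steps⇒reach F m s″) sat″ k } }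
        where
        descend : ∀ h {x} (c : Chain F h x) → Agrees (V 0) h c → ∀ {z′ z″} → Reach F x z′ → ¬ V 0 z′ →
          Reach F z′ z″ → Sat F V z″ (δ t) → ¬ ¬ (suc t ≤ h)
        descend zero c ag xz′ ¬p _ _ _ = ¬p (proj₂ (ag _ xz′) xz′)
        descend (suc h) C@(v , u , xv , _ , vu , _ , c) ag {z′} {z″} xz′ ¬p z′z″ sat″ k =
          ¬¬-excluded-middle λ
            { (no ¬vz′) → ¬p (proj₂ (ag z′ xz′) (inj₁ (xz′ , ¬vz′)))
            ; (yes vz′) → δ⇒p t sat″ λ Pz″ →
                δ-bound h c (λ z uz → agrees-tail h C ag z (vu ◅◅ uz)) t
                  (layers⊆ h c (proj₁ (agrees-tail h C ag z″ (vz′ ◅◅ z′z″)) Pz″)) sat″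
                  λ le → k (s≤s le) }

  private
    finite-height = repetition {𝓒 = 𝓕} 𝓕-finite δ δ-vars

  height : ℕ
  height = proj₁ finite-height

  -- The root would satisfy `δ height`, hence an equivalent `δ t` with `t > height`, against
  -- `δ-bound`.
  no-chain : ∀ F → 𝓕 F → ∀ {x} → ¬ Chain F height x
  no-chain F F∈ {x} c =
    δ-bound F F∈ V height c agrees (proj₁ (proj₂ finite-height)) ε
      (proj₁ (proj₂ (proj₂ (proj₂ finite-height)) F F∈ V x) (δ-top F F∈ V height c agrees))
      (ℕ.<⇒≱ (proj₁ (proj₂ (proj₂ finite-height))))
    where
    V : ℕ → W F → Set
    V _ = layers F F∈ height c
    agrees : Agrees F F∈ (V 0) height c
    agrees z _ = id , id

-- Small clusters and bounded height

Injective : {A : Set} {n : ℕ} → (Fin n → A) → Set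
Injective e = ∀ i j → e i ≡ e j → i ≡ j

LargeCluster : Frame I → ℕ → Set
LargeCluster F n = Σ (Fin n → W F) λ e → Injective e × ∀ i j → Reach F (e i) (e j)

module _ (F : Frame I) where

  Same : W F → W F → Set
  Same x y = Reach F x y × Reach F y x

  -- Starting from `x`, a list of distinct points either misses a point of the cluster, which
  -- extends it, or is exhaustive.
  enumerate-cluster : ∀ n x → ¬ ¬
    ( (Σ (Fin (suc n) → W F) λ e → Injective e × ∀ i → Same x (e i))
    ⊎ (Σ (Fin n → W F) λ e → (∀ i → Same x (e i)) × ∀ y → Same x y → ¬ ¬ ∃ λ i → e i ≡ y))
  enumerate-cluster zero x k = k (inj₁ ((λ _ → x) , (λ { zero zero _ → refl }) , λ _ → ε , ε))
  enumerate-cluster (suc n) x k = enumerate-cluster n x λ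
    -- Already exhaustive: `x` is repeated to reach the required length.
    { (inj₂ (e , same , onto)) → k (inj₂
        ( (λ { zero → x ; (suc i) → e i })
        , (λ { zero → ε , ε ; (suc i) → same i })
        , λ y xy k′ → onto y xy λ { (i , eq) → k′ (suc i , eq) }))
    ; (inj₁ (e , inj , same)) → ¬¬-excluded-middle {A = ∃ λ y → Same x y × ¬ ∃ λ i → e i ≡ y} λ
        { (yes (y , xy , new)) → k (inj₁
            ( (λ { zero → y ; (suc i) → e i })
            , (λ { zero zero _ → refl
                 ; zero (suc j) eq → ⊥-elim (new (j , sym eq))
                 ; (suc i) zero eq → ⊥-elim (new (i , eq))
                 ; (suc i) (suc j) eq → cong suc (inj i j eq) })
            , λ { zero → xy ; (suc i) → same i }))
        ; (no none) → k (inj₂ (e , same , λ y xy new → none (y , xy , new))) } }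

  module _ (N : ℕ) (small : ¬ LargeCluster F (suc N)) where

    -- The list `e` exhausts the cluster of `x`; a successor of a listed point reaches `x` and is
    -- listed, or is strictly above `x`.
    bounded-step : ∀ d x → (∀ y → Reach F x y → ¬ Reach F y x → Bounded F N d y) → Bounded F N (suc d) x
    bounded-step d x above k = enumerate-cluster N x λ
      { (inj₁ (e , inj , same)) → small (e , inj , λ i j → proj₂ (same i) ◅◅ proj₁ (same j))
      ; (inj₂ (e , same , onto)) → onto x (ε , ε) λ { (c , eq) → k (e , (c , eq) , λ c′ i y r k′ →
          let xy = proj₁ (same c′) ◅◅ (i , r) ◅ ε
          in ¬¬-excluded-middle λ
            { (yes yx) → onto y (xy , yx) λ { (c″ , eq′) → k′ (inj₁ (c″ , eq′)) }
            ; (no ¬yx) → k′ (inj₂ (above y xy ¬yx)) }) } }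

    unbounded-above : ∀ d x → ¬ Bounded F N (suc d) x →
      ¬ ¬ ∃ λ y → Reach F x y × ¬ Reach F y x × ¬ Bounded F N d y
    unbounded-above d x ¬b k = ¬b (bounded-step d x λ y xy ¬yx →
      Bounded-stable F N d y λ ¬b′ → k (y , xy , ¬yx , ¬b′))

    -- Each ascent lowers the height bound by one, and a chain unit takes two ascents; hence
    -- `h * 2`.
    unbounded⇒chain : ∀ h x → ¬ Bounded F N (h * 2) x → ¬ ¬ Chain F h x
    unbounded⇒chain zero x _ k = k tt
    unbounded⇒chain (suc h) x ¬b k =
      unbounded-above (suc (h * 2)) x ¬b λ { (v , xv , ¬vx , ¬bv) →
      unbounded-above (h * 2) v ¬bv λ { (u , vu , ¬uv , ¬bu) →
      unbounded⇒chain h u ¬bu λ c → k (v , u , xv , ¬vx , vu , ¬uv , c) } }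

-- The staircase: two large clusters contradict 1-finiteness of the product

module Staircase {a b : ℕ} (𝓕 : Class (Fin a)) (𝓖 : Class (Fin b))
  (𝓕-finite : KFinite 1 (Log 𝓕)) (𝓖-finite : KFinite 1 (Log 𝓖)) where

  open OneSided 𝓕 𝓕-finite using () renaming (m to mₕ; reach⇒steps to reach⇒stepsₕ)
  open OneSided 𝓖 𝓖-finite using () renaming (m to mᵥ; reach⇒steps to reach⇒stepsᵥ)
  module H = Iterated {I = Fin a ⊎ Fin b} inj₁
  module U = Iterated {I = Fin a ⊎ Fin b} inj₂

  P : Form (Fin a ⊎ Fin b)
  P = var 0

  row : Form (Fin a ⊎ Fin b) → Form (Fin a ⊎ Fin b)
  row φ = φ ∧' H.◇≤ mₕ (φ ∧' ¬' P)

  column : Form (Fin a ⊎ Fin b) → Form (Fin a ⊎ Fin b)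
  column φ = φ ∧' U.◇≤ mᵥ (φ ∧' P)

  -- On the grid {0,…,n-1}² with P = {(i,j) : i ≤ j}, the formula Q t defines {0,…,n-1-t}²: row removes
  -- the last row, the only one without ¬ P, and then column removes the last column.
  Q : ℕ → Form (Fin a ⊎ Fin b)
  Q zero = ⊤'
  Q (suc t) = column (row (Q t))

  Q-vars : ∀ t → InVars 1 (Q t)
  Q-vars zero = ⊥' ⇒ ⊥'
  Q-vars (suc t) = ∧-vars row-vars (U.◇≤-vars mᵥ (∧-vars row-vars P-vars))
    where
    P-vars : InVars 1 P
    P-vars = var (s≤s z≤n)
    row-vars : InVars 1 (row (Q t))
    row-vars = ∧-vars (Q-vars t) (H.◇≤-vars mₕ (∧-vars (Q-vars t) (¬-vars P-vars)))

  module _ (F : Frame (Fin a)) (G : Frame (Fin b)) where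

    steps-h : ∀ m {x x′ y} → Iterated.Steps id F m x x′ → H.Steps (F ⊗ G) m (x , y) (x′ , y)
    steps-h zero refl = refl
    steps-h (suc m) (inj₁ refl) = inj₁ refl
    steps-h (suc m) (inj₂ (i , z , r , s)) = inj₂ (i , _ , (r , refl) , steps-h m s)

    steps-v : ∀ m {x y y′} → Iterated.Steps id G m y y′ → U.Steps (F ⊗ G) m (x , y) (x , y′)
    steps-v zero refl = refl
    steps-v (suc m) (inj₁ refl) = inj₁ refl
    steps-v (suc m) (inj₂ (i , z , r , s)) = inj₂ (i , _ , (refl , r) , steps-v m s)

    steps-h-fixes : ∀ m {u w} → H.Steps (F ⊗ G) m u w → proj₂ u ≡ proj₂ w
    steps-h-fixes zero refl = refl
    steps-h-fixes (suc m) (inj₁ refl) = refl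
    steps-h-fixes (suc m) (inj₂ (i , z , (_ , eq) , s)) = trans eq (steps-h-fixes m s)

    steps-v-fixes : ∀ m {u w} → U.Steps (F ⊗ G) m u w → proj₁ u ≡ proj₁ w
    steps-v-fixes zero refl = refl
    steps-v-fixes (suc m) (inj₁ refl) = refl
    steps-v-fixes (suc m) (inj₂ (i , z , (eq , _) , s)) = trans eq (steps-v-fixes m s)

  module Grid (F : Frame (Fin a)) (G : Frame (Fin b)) (F∈ : 𝓕 F) (G∈ : 𝓖 G) {n : ℕ}
    (xs : Fin n → W F) (xs-inj : Injective xs) (xs-reach : ∀ i j → Reach F (xs i) (xs j))
    (ys : Fin n → W G) (ys-inj : Injective ys) (ys-reach : ∀ i j → Reach G (ys i) (ys j)) where

    -- Points off the grid satisfy P, so they never witness ¬ P.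
    V : ℕ → W (F ⊗ G) → Set
    V _ (x , y) = ∀ i j → xs i ≡ x → ys j ≡ y → toℕ i ≤ toℕ j

    Holds : W (F ⊗ G) → Form (Fin a ⊎ Fin b) → Set
    Holds = Sat (F ⊗ G) V

    ¬P-witness : ∀ {x y} → Holds (x , y) (¬' P) →
      ¬ ¬ ∃₂ λ i j → xs i ≡ x × ys j ≡ y × toℕ j < toℕ i
    ¬P-witness ¬p k = ¬p λ ¬V → ¬V λ i j ex ey → decide i j ex ey
      where
      decide : ∀ i j → xs i ≡ _ → ys j ≡ _ → toℕ i ≤ toℕ j
      decide i j ex ey with toℕ i ℕ.≤? toℕ j
      ... | yes le = le
      ... | no ≰ = ⊥-elim (k (i , j , ex , ey , ℕ.≰⇒> ≰))

    -- Vacuous in columns off the grid, so the invariant can be claimed at all points.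
    ColumnBound : ℕ → W (F ⊗ G) → Set
    ColumnBound t (x , _) = ∀ i → xs i ≡ x → toℕ i + t < n

    -- The `¬ P` witness is a grid point with `j < i` and `i + t < n`; horizontal steps keep its row
    -- `j`.
    row-bound : ∀ t → (∀ w → Holds w (Q t) → ¬ ¬ ColumnBound t w) →
      ∀ x y → Holds (x , y) (row (Q t)) → ¬ ¬ ∃ λ j → ys j ≡ y × suc (toℕ j + t) < n
    row-bound t bound x y h k =
      H.◇≤-elim (F ⊗ G) V (Q t ∧' ¬' P) mₕ
        (proj₂ (∧-elim (F ⊗ G) V (x , y) (Q t) (H.◇≤ mₕ (Q t ∧' ¬' P)) h)) λ { (w , s , q∧¬p) →
      let q , ¬p = ∧-elim (F ⊗ G) V w (Q t) (¬' P) q∧¬p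
      in bound w q λ column< → ¬P-witness ¬p λ { (i , j , ex , ey , j<i) →
      k (j , trans ey (sym (steps-h-fixes F G mₕ s)) ,
         ℕ.≤-trans (s≤s (ℕ.+-monoˡ-≤ t j<i)) (column< i ex)) } }

    -- The `P` witness lies in the same column `i` and in a row `j` with `j + 1 + t < n`, and `P`
    -- gives `i ≤ j`.
    column-bound : ∀ t → (∀ w → Holds w (Q t) → ¬ ¬ ColumnBound t w) →
      ∀ w → Holds w (Q (suc t)) → ¬ ¬ ColumnBound (suc t) w
    column-bound t bound (x , y) h k =
      U.◇≤-elim (F ⊗ G) V (row (Q t) ∧' P) mᵥ
        (proj₂ (∧-elim (F ⊗ G) V (x , y) (row (Q t)) (U.◇≤ mᵥ (row (Q t) ∧' P)) h)) λ { ((x′ , y′) , s , r∧p) →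
      let r , p = ∧-elim (F ⊗ G) V (x′ , y′) (row (Q t)) P r∧p
      in row-bound t bound x′ y′ r λ { (j , ey , j<) → p λ Vxy →
      k λ i ex → subst (_< n) (sym (ℕ.+-suc (toℕ i) t))
        (ℕ.≤-trans (s≤s (s≤s (ℕ.+-monoˡ-≤ t (Vxy i j (trans ex (steps-v-fixes F G mᵥ s)) ey)))) j<) } }

    Q-bound : ∀ t w → Holds w (Q t) → ¬ ¬ ColumnBound t w
    Q-bound zero w _ k = k λ i _ → subst (_< n) (sym (ℕ.+-identityʳ (toℕ i))) (Fin.toℕ<n i)
    Q-bound (suc t) = column-bound t (Q-bound t)

    row-holds : ∀ t → (∀ i j → toℕ i + t < n → toℕ j + t < n → Holds (xs i , ys j) (Q t)) →
      ∀ i j → toℕ i + t < n → suc (toℕ j + t) < n → Holds (xs i , ys j) (row (Q t))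
    row-holds t holds i j i< j< =
      ∧-intro (F ⊗ G) V (xs i , ys j) (Q t) (H.◇≤ mₕ (Q t ∧' ¬' P)) (holds i j i< j<′) λ box →
        reach⇒stepsₕ F F∈ (xs-reach i i′) λ s →
          H.◇≤-intro (F ⊗ G) V (Q t ∧' ¬' P) mₕ (steps-h F G mₕ s)
            (∧-intro (F ⊗ G) V (xs i′ , ys j) (Q t) (¬' P)
              (holds i′ j (subst (λ l → l + t < n) (sym i′≡) j<) j<′)
              λ p → p λ Vxy → ℕ.<⇒≱ (ℕ.≤-reflexive (sym i′≡)) (Vxy i′ j refl refl)) box
      where
      j<′ = ℕ.<-trans (ℕ.n<1+n _) j<
      1+j<n : suc (toℕ j) < n
      1+j<n = ℕ.≤-trans (s≤s (s≤s (ℕ.m≤m+n (toℕ j) t))) j<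
      -- Column `j + 1` is the first in row `j` where `P` fails.
      i′ = fromℕ< 1+j<n
      i′≡ : toℕ i′ ≡ suc (toℕ j)
      i′≡ = Fin.toℕ-fromℕ< 1+j<n

    Q-holds : ∀ t i j → toℕ i + t < n → toℕ j + t < n → Holds (xs i , ys j) (Q t)
    Q-holds zero i j _ _ = id
    Q-holds (suc t) i j i< j< =
      ∧-intro (F ⊗ G) V (xs i , ys j) (row (Q t)) (U.◇≤ mᵥ (row (Q t) ∧' P))
        (row-holds t (Q-holds t) i j i<″ j<′) λ box →
        -- The `P` witness in column `i` is the diagonal point; injectivity makes `(i , i)` its only
        -- pair of indices.
        reach⇒stepsᵥ G G∈ (ys-reach j i) λ s →
          U.◇≤-intro (F ⊗ G) V (row (Q t) ∧' P) mᵥ (steps-v F G mᵥ s)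
            (∧-intro (F ⊗ G) V (xs i , ys i) (row (Q t)) P (row-holds t (Q-holds t) i i i<″ i<′)
              λ ¬V → ¬V λ i′ j′ ex ey →
                ℕ.≤-reflexive (cong toℕ (trans (xs-inj i′ i ex) (sym (ys-inj j′ i ey))))) box
      where
      i<′ = subst (_< n) (ℕ.+-suc (toℕ i) t) i<
      j<′ = subst (_< n) (ℕ.+-suc (toℕ j) t) j<
      i<″ = ℕ.<-trans (ℕ.n<1+n _) i<′

  module _ (product-finite : KFinite 1 (Log (𝓕 ⊗ᶜ 𝓖))) where

    private
      repeated = repetition {𝓒 = 𝓕 ⊗ᶜ 𝓖} product-finite Q Q-vars

    size : ℕ
    size = proj₁ repeated

    -- On a grid of side `size + 1` the corner satisfies `Q size`, hence some `Q t` with `t > size`,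
    -- while `Q-bound` forces `t < size + 1`.
    not-both-large : ∀ F G → 𝓕 F → 𝓖 G → LargeCluster F (suc size) → LargeCluster G (suc size) → ⊥
    not-both-large F G F∈ G∈ (xs , xs-inj , xs-reach) (ys , ys-inj , ys-reach) =
      Q-bound _ (xs zero , ys zero)
        (proj₁ (proj₂ (proj₂ (proj₂ repeated)) (F ⊗ G) (F , G , F∈ , G∈ , refl) V (xs zero , ys zero))
          (Q-holds size zero zero (ℕ.n<1+n size) (ℕ.n<1+n size)))
        λ bound → ℕ.<⇒≱ (bound zero refl) (proj₁ (proj₂ (proj₂ repeated)))
      where open Grid F G F∈ G∈ xs xs-inj xs-reach ys ys-inj ys-reach

-- Exchanging the factors

swapForm : {A B : Set} → Form (A ⊎ B) → Form (B ⊎ A)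
swapForm (var n) = var n
swapForm ⊥' = ⊥'
swapForm (φ ⇒ ψ) = swapForm φ ⇒ swapForm ψ
swapForm (□ i φ) = □ (swap i) (swapForm φ)

swapForm-vars : ∀ {A B : Set} {k} {φ : Form (A ⊎ B)} → InVars k φ → InVars k (swapForm φ)
swapForm-vars (var lt) = var lt
swapForm-vars ⊥' = ⊥'
swapForm-vars (v ⇒ w) = swapForm-vars v ⇒ swapForm-vars w
swapForm-vars (□ v) = □ (swapForm-vars v)

module _ {A B : Set} (F : Frame A) (G : Frame B) (V : ℕ → W (F ⊗ G) → Set) where

  swapV : ℕ → W (G ⊗ F) → Set
  swapV n (y , x) = V n (x , y)

  sat-swap : ∀ φ x y → Sat (F ⊗ G) V (x , y) φ ≃ Sat (G ⊗ F) swapV (y , x) (swapForm φ)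
  sat-swap (var n) x y = id , id
  sat-swap ⊥' x y = id , id
  sat-swap (φ ⇒ ψ) x y =
    (λ h s → proj₁ (sat-swap ψ x y) (h (proj₂ (sat-swap φ x y) s))) ,
    (λ h s → proj₂ (sat-swap ψ x y) (h (proj₁ (sat-swap φ x y) s)))
  sat-swap (□ (inj₁ i) φ) x y =
    (λ h (y′ , x′) (e , r) → proj₁ (sat-swap φ x′ y′) (h (x′ , y′) (r , e))) ,
    (λ h (x′ , y′) (r , e) → proj₂ (sat-swap φ x′ y′) (h (y′ , x′) (e , r)))
  sat-swap (□ (inj₂ j) φ) x y =
    (λ h (y′ , x′) (r , e) → proj₁ (sat-swap φ x′ y′) (h (x′ , y′) (e , r))) ,
    (λ h (x′ , y′) (e , r) → proj₂ (sat-swap φ x′ y′) (h (y′ , x′) (r , e)))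

-- Combining both cases

all-bounded : ∀ {a} (𝓕 : Class (Fin a)) (𝓕-finite : KFinite 1 (Log 𝓕)) (N : ℕ) → ∀ F → 𝓕 F →
  ¬ LargeCluster F (suc N) → ∀ x → Bounded F N (OneSided.height 𝓕 𝓕-finite * 2) x
all-bounded 𝓕 𝓕-finite N F F∈ small x =
  Bounded-stable F N (height * 2) x λ ¬b → unbounded⇒chain F N small height x ¬b (no-chain F F∈)
  where open OneSided 𝓕 𝓕-finite

same-type : ∀ {a b} (𝓖 : Class (Fin b)) (𝓖-tabular : LocallyTabular (Log 𝓖)) (k N : ℕ) {d : ℕ} →
  (l : Types.Level {a} 𝓖 𝓖-tabular k N d) → ∀ F G → 𝓖 G → ∀ V x g → Bounded F N d x →
  ∀ φ ψ → InVars k φ → InVars k ψ → Types.Level.κ l φ ≡ Types.Level.κ l ψ →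
  Sat (F ⊗ G) V (x , g) φ → Sat (F ⊗ G) V (x , g) ψ
same-type 𝓖 𝓖-tabular k N l F G G∈ V x g bounded φ ψ v w eq h =
  stable (F ⊗ G) V (x , g) ψ λ ¬ψ → realized F G G∈ V x g bounded λ { (t , real) →
    ¬ψ (proj₂ (real ψ w) (trans (sym (sat-cong eq t)) (proj₁ (real φ v) h))) }
  where open Types.Level l

alphabet : ∀ a b → List (Fin a ⊎ Fin b)
alphabet a b = map inj₁ (allFin a) ++ map inj₂ (allFin b)

alphabet-complete : ∀ a b i → i ∈ alphabet a b
alphabet-complete a b (inj₁ i) = ∈-++⁺ˡ (∈-map⁺ inj₁ (∈-allFin i))
alphabet-complete a b (inj₂ j) = ∈-++⁺ʳ (map inj₁ (allFin a)) (∈-map⁺ inj₂ (∈-allFin j))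

theorem3p22 : (a b : ℕ) (𝓕 : Class (Fin a)) (𝓖 : Class (Fin b)) →
    NonEmpty 𝓕 → NonEmpty 𝓖 →
    LocallyTabular (Log 𝓕) → LocallyTabular (Log 𝓖) →
    KFinite 1 (Log (𝓕 ⊗ᶜ 𝓖)) →
    LocallyTabular (Log (𝓕 ⊗ᶜ 𝓖))
theorem3p22 a b 𝓕 𝓖 _ _ 𝓕-tabular 𝓖-tabular product-finite k =
  Saturation.kfinite (alphabet a b) (alphabet-complete a b) k κ κ-congruence (Log (𝓕 ⊗ᶜ 𝓖)) sound
  where
  open Staircase 𝓕 𝓖 (𝓕-tabular 1) (𝓖-tabular 1) using (size; not-both-large)

  N = size product-finite
  d₁ = OneSided.height 𝓕 (𝓕-tabular 1) * 2
  d₂ = OneSided.height 𝓖 (𝓖-tabular 1) * 2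

  level₁ : Types.Level {a} 𝓖 𝓖-tabular k N d₁
  level₁ = Types.level 𝓖 𝓖-tabular k N d₁

  level₂ : Types.Level {b} 𝓕 𝓕-tabular k N d₂
  level₂ = Types.level 𝓕 𝓕-tabular k N d₂

  open Types.Level level₁ using () renaming (κ to κ₁; congruence to congruence₁)
  open Types.Level level₂ using () renaming (κ to κ₂; congruence to congruence₂)
  module C₁ = Congruence congruence₁
  module C₂ = Congruence congruence₂

  -- Which factor has small clusters varies with the frame, so a class records the outcome for both.
  κ : Form (Fin a ⊎ Fin b) → Fin _
  κ φ = combine (κ₁ φ) (κ₂ (swapForm φ))

  κ-split : ∀ {φ ψ} → κ φ ≡ κ ψ → κ₁ φ ≡ κ₁ ψ × κ₂ (swapForm φ) ≡ κ₂ (swapForm ψ)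
  κ-split {φ} {ψ} = Fin.combine-injective (κ₁ φ) (κ₂ (swapForm φ)) (κ₁ ψ) (κ₂ (swapForm ψ))

  κ-congruence : Congruence _ κ
  κ-congruence = record
    { ⇒-cong = λ {φ} {φ′} {ψ} {ψ′} e e′ →
        let e₁ , e₂ = κ-split {φ} {φ′} e
            e₁′ , e₂′ = κ-split {ψ} {ψ′} e′
        in cong₂ combine (C₁.⇒-cong {φ} {φ′} {ψ} {ψ′} e₁ e₁′) (C₂.⇒-cong {swapForm φ} {swapForm φ′} {swapForm ψ} {swapForm ψ′} e₂ e₂′)
    ; □-cong = λ i {φ} {φ′} e →
        let e₁ , e₂ = κ-split {φ} {φ′} e
        in cong₂ combine (C₁.□-cong i {φ} {φ′} e₁) (C₂.□-cong (swap i) {swapForm φ} {swapForm φ′} e₂) }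

  transfer : ∀ F G → 𝓕 F → 𝓖 G → ∀ V x y φ ψ → InVars k φ → InVars k ψ → κ φ ≡ κ ψ →
    Sat (F ⊗ G) V (x , y) φ → Sat (F ⊗ G) V (x , y) ψ
  transfer F G F∈ G∈ V x y φ ψ v w eq h = stable (F ⊗ G) V (x , y) ψ λ ¬ψ →
    ¬¬-excluded-middle {A = LargeCluster F (suc N)} λ
      { (no smallF) → ¬ψ (same-type 𝓖 𝓖-tabular k N level₁ F G G∈ V x y
          (all-bounded 𝓕 (𝓕-tabular 1) N F F∈ smallF x) φ ψ v w (proj₁ (κ-split {φ} {ψ} eq)) h)
      -- A large cluster in `F` excludes one in `G`, so the factors exchange roles.
      ; (yes largeF) → ¬ψ (proj₂ (sat-swap F G V ψ x y)
          (same-type 𝓕 𝓕-tabular k N level₂ G F F∈ (swapV F G V) y x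
            (all-bounded 𝓖 (𝓖-tabular 1) N G G∈ (not-both-large product-finite F G F∈ G∈ largeF) y)
            (swapForm φ) (swapForm ψ) (swapForm-vars v) (swapForm-vars w) (proj₂ (κ-split {φ} {ψ} eq))
            (proj₁ (sat-swap F G V φ x y) h))) }

  sound : ∀ φ ψ → InVars k φ → InVars k ψ → κ φ ≡ κ ψ → Log (𝓕 ⊗ᶜ 𝓖) (φ ⇔ ψ)
  sound φ ψ v w eq _ (F , G , F∈ , G∈ , refl) V (x , y) = ⇔-intro (F ⊗ G) V (x , y) φ ψ
    (transfer F G F∈ G∈ V x y φ ψ v w eq , transfer F G F∈ G∈ V x y ψ φ w v (sym eq))
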